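{- For every finite simple graph $G$, $\chi_2(G)-\chi(G)\le \alpha(G)+1$.
   Context: $\chi(G)$ is the chromatic number and $\alpha(G)$ the independence number of $G$. A dynamic coloring of $G$ is a proper vertex coloring such that for every vertex $v$ of degree at least $2$, the neighbours of $v$ receive at least two different colors; $\chi_2(G)$ is the smallest number of colors in a dynamic coloring of $G$. -}

module Defs where

open import Data.Nat using (ℕ; _≤_; _<_)
open import Data.Fin using (Fin)
open import Data.Fin.Subset using (Subset; _∈_; ∣_∣)
open import Data.Product using (Σ; _×_; ∃; ∃-syntax)
open import Relation.Binary.PropositionalEquality using (_≡_; _≢_)
open import Relation.Nullary using (¬_)
open import Level using (0ℓ)

record Graph (n : ℕ) : Set₁ where
  field
    Adj : Fin n → Fin n → Set
    sym : ∀ {u v} → Adj u v → Adj v u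
    irrefl : ∀ {v} → ¬ Adj v v
open Graph public

module _ {n : ℕ} (G : Graph n) where

  Proper : {k : ℕ} → (Fin n → Fin k) → Set
  Proper c = ∀ u v → Adj G u v → c u ≢ c v

  Deg≥2 : Fin n → Set
  Deg≥2 v = ∃[ u ] ∃[ w ] (u ≢ w × Adj G v u × Adj G v w)

  Dynamic : {k : ℕ} → (Fin n → Fin k) → Set
  Dynamic c = Proper c × (∀ v → Deg≥2 v →
                 ∃[ u ] ∃[ w ] (Adj G v u × Adj G v w × c u ≢ c w))

  Colorable : ℕ → Set
  Colorable k = Σ (Fin n → Fin k) Proper

  DynColorable : ℕ → Set
  DynColorable k = Σ (Fin n → Fin k) Dynamic

  IsChromaticNumber : ℕ → Set
  IsChromaticNumber k = Colorable k × (∀ j → j < k → ¬ Colorable j)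

  IsDynamicChromaticNumber : ℕ → Set
  IsDynamicChromaticNumber k = DynColorable k × (∀ j → j < k → ¬ DynColorable j)

  Independent : Subset n → Set
  Independent S = ∀ u v → u ∈ S → v ∈ S → ¬ Adj G u v

  IsIndependenceNumber : ℕ → Set
  IsIndependenceNumber a =
    (∃[ S ] (Independent S × ∣ S ∣ ≡ a)) × (∀ S → Independent S → ∣ S ∣ ≤ a)

{-# OPTIONS --safe #-}
-- Let S be maximal among the independent sets containing no neighbourhood of
-- a vertex of degree ≥ 2. Suppose v has no neighbour in S. If v ∉ S,
-- maximality provides a neighbour w of v, of degree ≥ 2, with N(w) ⊆ S ∪ {v};
-- call every w arising in this way a blocker. Blockers have a neighbour in S,
-- and any two adjacent blockers w, w' would give w' ∈ S ∪ {v}, which is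
-- impossible since neither S nor v has a neighbour in S. So the blockers,
-- together with the elements of S not adjacent to a blocker, form an
-- independent set A. Let T consist of the blockers and one neighbour of each
-- other element of A. Every vertex of degree ≥ 2 without neighbours in S has
-- a neighbour in T, and |T| ≤ |A| ≤ α.
-- Starting from a proper χ-colouring, give the vertices of T distinct new
-- colours and all of S ∖ T one further new colour. A neighbourhood meeting T
-- contains a colour used only once; one that misses T meets S, and is not
-- contained in S.
module Submission where

open import Defs
open import Data.Nat using (ℕ; suc; _≤_; _+_; _∸_; s≤s)
open import Data.Nat.Properties
  using (_≤?_; ≮⇒≥; ≤-trans; +-monoʳ-≤; +-comm; m≤n+o⇒m∸n≤o)
open import Data.Bool using (true)
open import Data.Empty using (⊥-elim)
open import Data.Fin using (Fin; zero; suc; join; splitAt; _≟_)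
open import Data.Fin.Properties using (any?; all?; sequence; splitAt-join)
open import Data.Fin.Subset
  using (Subset; _∈_; _∉_; ∣_∣; _∪_; ⁅_⁆; _⊃_; inside; outside)
  renaming (⊥ to ∅)
open import Data.Fin.Subset.Induction using (Acc; acc; ⊃-wellFounded)
open import Data.Fin.Subset.Properties
  using (_∈?_; ∉⊥; p⊆p∪q; q⊆p∪q; x∈⁅x⁆; x∈⁅y⁆⇒x≡y; x∈p∪q⁻)
open import Data.Product using (_×_; _,_; proj₁; proj₂; ∃-syntax)
open import Data.Sum using (_⊎_; inj₁; inj₂)
open import Data.Sum.Properties using (inj₁-injective; inj₂-injective)
open import Data.Vec using (_∷_; here; there; tabulate)
open import Data.Vec.Properties using (lookup∘tabulate; lookup⇒[]=; []=⇒lookup)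
open import Effect.Monad using (RawMonad)
open import Function using (_∘_)
open import Level using (0ℓ)
open import Relation.Binary.PropositionalEquality
  using (_≡_; _≢_; refl; trans; cong; subst)
  renaming (sym to ≡-sym)
open import Relation.Nullary using (¬_; Dec; yes; no; contradiction)
open import Relation.Nullary.Decidable
  using (does; dec-true; ¬?; _×-dec_; _⊎-dec_; _→-dec_; decidable-stable; ¬¬-excluded-middle)
open import Relation.Nullary.Negation using (¬¬-Monad; ¬¬-map)
open import Relation.Unary using (Pred; Decidable)

-- Finite subsets, maximal sets and double negation.

module _ {n : ℕ} {P : Pred (Fin n) 0ℓ} (P? : Decidable P) where

  comprehension : Subset n
  comprehension = tabulate (does ∘ P?)

  ∈-comprehension⁺ : ∀ {x} → P x → x ∈ comprehension
  ∈-comprehension⁺ {x} px =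
    lookup⇒[]= x _ (trans (lookup∘tabulate (does ∘ P?) x) (dec-true (P? x) px))

  ∈-comprehension⁻ : ∀ {x} → x ∈ comprehension → P x
  ∈-comprehension⁻ {x} x∈ = witness (P? x)
    (trans (≡-sym (lookup∘tabulate (does ∘ P?) x)) ([]=⇒lookup x∈))
    where
    witness : (d : Dec (P x)) → does d ≡ true → P x
    witness (yes px) _ = px

element : ∀ {n} (p : Subset n) → Fin ∣ p ∣ → Fin n
element (inside  ∷ p) zero    = zero
element (inside  ∷ p) (suc i) = suc (element p i)
element (outside ∷ p) i       = suc (element p i)

element-surjective : ∀ {n} (p : Subset n) {x} → x ∈ p → ∃[ i ] element p i ≡ x
element-surjective (inside ∷ p)  here = zero , refl
element-surjective (inside ∷ p)  (there x∈p) with element-surjective p x∈p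
... | i , refl = suc i , refl
element-surjective (outside ∷ p) (there x∈p) with element-surjective p x∈p
... | i , refl = i , refl

-- Elements are added greedily; strict growth inside `Fin n` is well founded. Maximality is against
-- adding single elements, the form that blockers answer.
maximal-extension : ∀ {n} {P : Pred (Subset n) 0ℓ} → Decidable P → ∀ S → P S →
  ∃[ M ] (P M × (∀ v → P (M ∪ ⁅ v ⁆) → v ∈ M))
maximal-extension {n} {P} P? S₀ = extend S₀ (⊃-wellFounded S₀)
  where
  extend : ∀ S → Acc _⊃_ S → P S → ∃[ M ] (P M × (∀ v → P (M ∪ ⁅ v ⁆) → v ∈ M))
  extend S (acc rs) pS with any? (λ v → ¬? (v ∈? S) ×-dec P? (S ∪ ⁅ v ⁆))
  ... | yes (v , v∉S , p) =
    extend (S ∪ ⁅ v ⁆)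
      (rs (p⊆p∪q ⁅ v ⁆ , v , q⊆p∪q S ⁅ v ⁆ (x∈⁅x⁆ v) , v∉S)) p
  ... | no none =
    S , pS , λ v p → decidable-stable (v ∈? S) λ v∉S → none (v , v∉S , p)

-- Excluded middle holds under double negation for each pair, and `sequence` carries double negation
-- through finite products.
¬¬-decidable₂ : ∀ {n} (R : Fin n → Fin n → Set) → ¬ ¬ (∀ u v → Dec (R u v))
¬¬-decidable₂ R =
  sequence applicative λ u → sequence applicative λ v → ¬¬-excluded-middle
  where applicative = RawMonad.rawApplicative ¬¬-Monad

join-injective : ∀ m n {i j : Fin m ⊎ Fin n} → join m n i ≡ join m n j → i ≡ j
join-injective m n {i} {j} eq =
  trans (≡-sym (splitAt-join m n i)) (trans (cong (splitAt m) eq) (splitAt-join m n j))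

-- Free sets and their blockers.

module _ {n : ℕ} (G : Graph n) where

  other-neighbour : ∀ {v} → Deg≥2 G v → ∀ x → ∃[ u ] (Adj G v u × u ≢ x)
  other-neighbour (u , w , u≢w , vu , vw) x with u ≟ x
  ... | yes refl = w , vw , u≢w ∘ ≡-sym
  ... | no  u≢x  = u , vu , u≢x

  -- The neighbour outside `S` is exhibited because it later supplies the second colour around `w`.
  Free : Subset n → Set
  Free S = Independent G S × (∀ w → Deg≥2 G w → ∃[ u ] (Adj G w u × u ∉ S))

  Avoids : Subset n → Fin n → Set
  Avoids S v = ∀ u → Adj G v u → u ∉ S

  Blocks : Subset n → Fin n → Fin n → Set
  Blocks S w v = Adj G w v × Deg≥2 G w × (∀ u → Adj G w u → u ∈ S ⊎ u ≡ v)

  Blocker : Subset n → Fin n → Set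
  Blocker S w = ∃[ v ] (Avoids S v × Blocks S w v)

  module _ (adj? : ∀ u v → Dec (Adj G u v)) where

    deg≥2? : Decidable (Deg≥2 G)
    deg≥2? v = any? λ u → any? λ w → ¬? (u ≟ w) ×-dec (adj? v u ×-dec adj? v w)

    free? : Decidable Free
    free? S =
      (all? λ u → all? λ v → (u ∈? S) →-dec ((v ∈? S) →-dec ¬? (adj? u v)))
      ×-dec (all? λ w → deg≥2? w →-dec any? λ u → adj? w u ×-dec ¬? (u ∈? S))

    avoids? : ∀ S → Decidable (Avoids S)
    avoids? S v = all? λ u → adj? v u →-dec ¬? (u ∈? S)

    blocks? : ∀ S w v → Dec (Blocks S w v)
    blocks? S w v = adj? w v ×-dec (deg≥2? w ×-dec
      (all? λ u → adj? w u →-dec ((u ∈? S) ⊎-dec (u ≟ v))))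

    blocker? : ∀ S → Decidable (Blocker S)
    blocker? S w = any? λ v → avoids? S v ×-dec blocks? S w v

    module _ {S : Subset n} (free : Free S) where

      -- If a `w` of degree at least 2 had all its neighbours in the enlarged set, then, `S` being
      -- free, one of them would be `v`, so `w` would block `v`.
      free-extension : ∀ {v} → Avoids S v → (∀ w → ¬ Blocks S w v) → Free (S ∪ ⁅ v ⁆)
      free-extension {v} v∌S unblocked = independent , escape
        where
        S+v = S ∪ ⁅ v ⁆

        independent : Independent G S+v
        independent x y x∈ y∈ xy with x∈p∪q⁻ S ⁅ v ⁆ x∈ | x∈p∪q⁻ S ⁅ v ⁆ y∈
        ... | inj₁ x∈S | inj₁ y∈S = proj₁ free x y x∈S y∈S xy
        ... | inj₁ x∈S | inj₂ y∈v with refl ← x∈⁅y⁆⇒x≡y v y∈v = v∌S x (sym G xy) x∈S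
        ... | inj₂ x∈v | inj₁ y∈S with refl ← x∈⁅y⁆⇒x≡y v x∈v = v∌S y xy y∈S
        ... | inj₂ x∈v | inj₂ y∈v
          with refl ← x∈⁅y⁆⇒x≡y v x∈v | refl ← x∈⁅y⁆⇒x≡y v y∈v = irrefl G xy

        escape : ∀ w → Deg≥2 G w → ∃[ u ] (Adj G w u × u ∉ S+v)
        escape w deg with any? (λ u → adj? w u ×-dec ¬? (u ∈? S+v))
        ... | yes found = found
        ... | no  none  = ⊥-elim (unblocked w (wv , deg , inside-S+v))
          where
          inside-S+v : ∀ u → Adj G w u → u ∈ S ⊎ u ≡ v
          inside-S+v u wu
            with x∈p∪q⁻ S ⁅ v ⁆ (decidable-stable (u ∈? S+v) λ u∉ → none (u , wu , u∉))
          ... | inj₁ u∈S = inj₁ u∈S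
          ... | inj₂ u∈v = inj₂ (x∈⁅y⁆⇒x≡y v u∈v)

          wv : Adj G w v
          wv with proj₂ free w deg
          ... | u , wu , u∉S with inside-S+v u wu
          ...   | inj₁ u∈S  = contradiction u∈S u∉S
          ...   | inj₂ refl = wu

      blocker-neighbour : ∀ {w} → Blocker S w → ∃[ s ] (Adj G w s × s ∈ S)
      blocker-neighbour (v , _ , _ , deg , N⊆S+v) with other-neighbour deg v
      ... | u , wu , u≢v with N⊆S+v u wu
      ...   | inj₁ u∈S = u , wu , u∈S
      ...   | inj₂ u≡v = contradiction u≡v u≢v

      blocker∉S : ∀ {w} → Blocker S w → w ∉ S
      blocker∉S bw w∈S with blocker-neighbour bw
      ... | s , ws , s∈S = proj₁ free _ s w∈S s∈S ws

      blockers-nonadjacent : ∀ {w w′} → Blocker S w → Blocker S w′ → ¬ Adj G w w′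
      blockers-nonadjacent (v , v∌S , _ , _ , N⊆S+v) bw′ ww′ with N⊆S+v _ ww′
      ... | inj₁ w′∈S = blocker∉S bw′ w′∈S
      -- Here `w′` is the vertex blocked by `w`: it avoids `S`, yet as a blocker it has a neighbour
      -- there.
      ... | inj₂ refl with blocker-neighbour bw′
      ...   | s , w′s , s∈S = v∌S s w′s s∈S

      -- The independent set and its targets.

      Selected : Fin n → Set
      Selected x = Blocker S x ⊎ (x ∈ S × (∀ w → Adj G x w → ¬ Blocker S w))

      selected? : Decidable Selected
      selected? x = blocker? S x ⊎-dec
        ((x ∈? S) ×-dec all? λ w → adj? x w →-dec ¬? (blocker? S w))

      -- The mixed cases are why `Selected` drops the elements of `S` adjacent to a blocker.
      selected-independent : Independent G (comprehension selected?)
      selected-independent x y x∈ y∈ =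
        nonadjacent (∈-comprehension⁻ selected? x∈) (∈-comprehension⁻ selected? y∈)
        where
        nonadjacent : ∀ {x y} → Selected x → Selected y → ¬ Adj G x y
        nonadjacent (inj₁ bx)        (inj₁ by)        xy = blockers-nonadjacent bx by xy
        nonadjacent (inj₁ bx)        (inj₂ (_ , y∌B)) xy = y∌B _ (sym G xy) bx
        nonadjacent (inj₂ (_ , x∌B)) (inj₁ by)        xy = x∌B _ xy by
        nonadjacent (inj₂ (x∈S , _)) (inj₂ (y∈S , _)) xy = proj₁ free _ _ x∈S y∈S xy

      -- The last value, at isolated vertices, is junk.
      target : Fin n → Fin n
      target x with blocker? S x
      ... | yes _ = x
      ... | no  _ with any? (adj? x)
      ...   | yes (y , _) = y
      ...   | no  _       = x

      target-blocker : ∀ {x} → Blocker S x → target x ≡ x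
      target-blocker {x} bx with blocker? S x
      ... | yes _  = refl
      ... | no ¬bx = contradiction bx ¬bx

      target-adjacent : ∀ {x y} → ¬ Blocker S x → Adj G x y → Adj G x (target x)
      target-adjacent {x} {y} ¬bx xy with blocker? S x
      ... | yes bx = contradiction bx ¬bx
      ... | no  _ with any? (adj? x)
      ...   | yes (_ , xz) = xz
      ...   | no  none     = contradiction (y , xy) none

      -- A blocker adjacent to `v` is its own target. Without one, nothing blocks `v`, so maximality
      -- puts `v` into `S`; then `v` itself is selected, and its target is one of its neighbours.
      targets-dominate : (∀ v → Free (S ∪ ⁅ v ⁆) → v ∈ S) → ∀ v → Deg≥2 G v → Avoids S v →
        ∃[ x ] (Selected x × Adj G v (target x))
      targets-dominate maximal v (y , _ , _ , vy , _) v∌S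
        with any? (λ w → adj? v w ×-dec blocker? S w)
      ... | yes (w , vw , bw) = w , inj₁ bw , subst (Adj G v) (≡-sym (target-blocker bw)) vw
      ... | no  v∌B =
        v , inj₂ (v∈S , λ w vw bw → v∌B (w , vw , bw)) ,
        target-adjacent (λ bv → blocker∉S bv v∈S) vy
        where
        v∈S : v ∈ S
        v∈S = maximal v (free-extension v∌S
          λ w blocks → v∌B (w , sym G (proj₁ blocks) , v , v∌S , blocks))

      -- Recolouring along a family of vertices.

      module _ {k m : ℕ} {c : Fin n → Fin k} (proper : Proper G c) (t : Fin m → Fin n) where

        Hit : Fin n → Set
        Hit v = ∃[ i ] t i ≡ v

        hit? : Decidable Hit
        hit? v = any? λ i → t i ≟ v

        -- `t` may repeat vertices, so `hit?` fixes one index for each hit vertex; `zero` is shared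
        -- by the rest of `S`.
        recolour : Fin n → Fin k ⊎ Fin (suc m)
        recolour v with hit? v | v ∈? S
        ... | yes (i , _) | _     = inj₂ (suc i)
        ... | no _        | yes _ = inj₂ zero
        ... | no _        | no  _ = inj₁ (c v)

        -- The index stored in the colour determines the vertex through `t`.
        hit-unique : ∀ {u v} → Hit u → recolour u ≡ recolour v → u ≡ v
        hit-unique {u} {v} hu eq with hit? u | u ∈? S | hit? v | v ∈? S
        ... | no ¬hu       | _ | _            | _     = contradiction hu ¬hu
        ... | yes (i , ui) | _ | yes (j , vj) | _
          with refl ← inj₂-injective eq = trans (≡-sym ui) vj
        hit-unique _ () | yes _ | _ | no _ | yes _
        hit-unique _ () | yes _ | _ | no _ | no  _

        reused≢kept : ∀ {u v} → ¬ Hit u → ¬ Hit v → u ∈ S → v ∉ S → recolour u ≢ recolour v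
        reused≢kept {u} {v} ¬hu ¬hv u∈S v∉S eq with hit? u | u ∈? S | hit? v | v ∈? S
        ... | yes hu | _      | _      | _       = ¬hu hu
        ... | no _   | no u∉S | _      | _       = u∉S u∈S
        ... | no _   | yes _  | yes hv | _       = ¬hv hv
        ... | no _   | yes _  | no _   | yes v∈S = v∉S v∈S
        reused≢kept _ _ _ _ () | no _ | yes _ | no _ | no _

        -- Equal colours are of the same kind: a hit colour forces equal vertices, `zero`
        -- contradicts independence of `S`, an old colour contradicts `proper`.
        recolour-proper : ∀ u v → Adj G u v → recolour u ≢ recolour v
        recolour-proper u v uv eq with hit? u | u ∈? S | hit? v | v ∈? S
        ... | yes (i , ui) | _ | yes (j , vj) | _ with refl ← inj₂-injective eq
          with refl ← trans (≡-sym ui) vj = irrefl G uv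
        ... | no _ | yes u∈S | no _ | yes v∈S = proj₁ free u v u∈S v∈S uv
        ... | no _ | no _    | no _ | no _    = proper u v uv (inj₁-injective eq)
        recolour-proper _ _ _ () | yes _ | _     | no _  | yes _
        recolour-proper _ _ _ () | yes _ | _     | no _  | no _
        recolour-proper _ _ _ () | no _  | yes _ | yes _ | _
        recolour-proper _ _ _ () | no _  | no _  | yes _ | _
        recolour-proper _ _ _ () | no _  | yes _ | no _  | no _
        recolour-proper _ _ _ () | no _  | no _  | no _  | yes _

        recolour-dynamic :
          (∀ v → Deg≥2 G v → Avoids S v → ∃[ i ] Adj G v (t i)) →
          ∀ v → Deg≥2 G v → ∃[ u ] ∃[ w ] (Adj G v u × Adj G v w × recolour u ≢ recolour w)
        recolour-dynamic dominates v deg with any? (λ u → adj? v u ×-dec hit? u)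
        ... | yes (u , vu , hu) with other-neighbour deg u
        ...   | w , vw , w≢u = u , w , vu , vw , λ eq → w≢u (≡-sym (hit-unique hu eq))
        recolour-dynamic dominates v deg | no unhit
          with any? (λ u → adj? v u ×-dec (u ∈? S)) | proj₂ free v deg
        -- No neighbour is hit, so `u` has colour `zero`, while `w`, supplied by freeness, keeps its
        -- old colour.
        ... | yes (u , vu , u∈S) | w , vw , w∉S =
          u , w , vu , vw ,
          reused≢kept (λ hu → unhit (u , vu , hu)) (λ hw → unhit (w , vw , hw)) u∈S w∉S
        ... | no v∌S | _ with dominates v deg (λ u vu u∈S → v∌S (u , vu , u∈S))
        ...   | i , vti = ⊥-elim (unhit (t i , vti , i , refl))

        dynColorable : (∀ v → Deg≥2 G v → Avoids S v → ∃[ i ] Adj G v (t i)) →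
          DynColorable G (k + suc m)
        dynColorable dominates =
          join k (suc m) ∘ recolour ,
          (λ u v uv → recolour-proper u v uv ∘ join-injective k (suc m)) ,
          λ v deg → let u , w , vu , vw , u≢w = recolour-dynamic dominates v deg
                    in u , w , vu , vw , u≢w ∘ join-injective k (suc m)

    -- Assembling the bound.

    free-∅ : Free ∅
    free-∅ = (λ _ _ u∈∅ → ⊥-elim (∉⊥ u∈∅)) , λ _ (u , _ , _ , wu , _) → u , wu , ∉⊥

    independent-dynColorable : ∀ {k} → Colorable G k →
      ∃[ A ] (Independent G A × DynColorable G (k + suc ∣ A ∣))
    independent-dynColorable (c , proper) with maximal-extension free? ∅ free-∅
    ... | S , free , maximal =
      -- Indexing by `element A` takes `∣ A ∣` new colours, even if targets coincide.
      A , selected-independent free , dynColorable free proper (target free ∘ element A) dominates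
      where
      A = comprehension (selected? free)

      dominates : ∀ v → Deg≥2 G v → Avoids S v → ∃[ i ] Adj G v (target free (element A i))
      dominates v deg v∌S =
        let x , sx , vtx = targets-dominate free maximal v deg v∌S
            i , i↦x      = element-surjective A (∈-comprehension⁺ (selected? free) sx)
        in i , subst (Adj G v ∘ target free) (≡-sym i↦x) vtx

-- Adjacency is not assumed decidable, but the inequality is, so it may be proved
-- under a double negation.
theorem5 : ∀ (n : ℕ) (G : Graph n) (χ χ₂ α : ℕ) →
    IsChromaticNumber G χ → IsDynamicChromaticNumber G χ₂ →
    IsIndependenceNumber G α → χ₂ ∸ χ ≤ α + 1
theorem5 n G χ χ₂ α (colorable , _) (_ , χ₂-least) (_ , α-greatest) =
  decidable-stable (χ₂ ∸ χ ≤? α + 1) (¬¬-map bound (¬¬-decidable₂ (Adj G)))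
  where
  bound : (∀ u v → Dec (Adj G u v)) → χ₂ ∸ χ ≤ α + 1
  bound adj? =
    let A , independent , dynamic = independent-dynColorable G adj? colorable
    in subst (χ₂ ∸ χ ≤_) (+-comm 1 α)
         (m≤n+o⇒m∸n≤o χ₂ χ (≤-trans
           -- Minimality of `χ₂` is applied to the colouring just built; `suc` counts the colour
           -- shared by `S` outside the targets.
           (≮⇒≥ λ small → χ₂-least (χ + suc ∣ A ∣) small dynamic)
           (+-monoʳ-≤ χ (s≤s (α-greatest A independent)))))
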